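{- Define $R^{(3)}\colon\mathbb Z_{\ge0}^3\to\mathbb Z_{\ge0}^3$ by \[ R^{(3)}(a,h,c)=\bigl(h+\max(a-c,0),\;\min(a,c),\;h+\max(c-a,0)\bigr). \] For a boundary $(i_1,i_2,i_3,j_1,j_2,j_3)$ and a state $k_1$ of the Schur matching (see context), put $h=\min(k_1,k_2)$ and $m=\min(j_1,j_2)$. (i) Under the deterministic Schur matching $k_1\mapsto k_1'$, the three active occupations transform as \[ (j_1,h,j_2)\longmapsto(k_1',m,k_2')=R^{(3)}(j_1,h,j_2). \] (ii) Consequently, after adjoining the fixed boundary data $(i_1,i_2,i_3,j_1,j_2,j_3)$ needed to reconstruct the remaining arrows through \[ k_1=h+\max(i_1-i_2,0),\quad k_2=h+\max(i_2-i_1,0),\quad k_3=i_3+j_1-k_1,\quad k_3'=j_3+i_1-k_1', \] the Schur matching is the restriction of $R^{(3)}$ to a finite boundary-dependent slice of $\mathbb Z_{\ge0}^3$, namely the set of triples $(j_1,\min(k_1,k_2),j_2)$ with $k_1$ ranging over the admissible states of that boundary. (iii) The map $R^{(3)}$ is an involutive set-theoretic tetrahedron map: $R^{(3)}\circ R^{(3)}=\mathrm{id}$, and, with $R=R^{(3)}$, \[ R_{123}\,R_{145}\,R_{246}\,R_{356}=R_{356}\,R_{246}\,R_{145}\,R_{123}\qquad\text{on }\mathbb Z_{\ge0}^6, \] where $R_{abc}$ applies $R$ to the factors $a,b,c$ (in this order) and acts as the identity on the other three. (iv) Conversely, every triple $(a,h,c)\in\mathbb Z_{\ge0}^3$ arises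 as the active triple $(j_1,\min(k_1,k_2),j_2)$ of the Schur matching for some boundary and some admissible state $k_1$ of it. Thus $R^{(3)}$ on all of $\mathbb Z_{\ge0}^3$ is assembled from the Schur matchings over the various boundaries.
   Context: A boundary is a tuple $(i_1,i_2,i_3,j_1,j_2,j_3)\in\mathbb Z_{\ge0}^6$ with $i_1+j_2+j_3=i_2+i_3+j_1$. For a fixed boundary, the admissible (left) states are the integers $k_1$ with $\max(0,i_1-i_2)\le k_1\le\min(i_3,\,i_3+j_1-j_2)$, and one sets $k_2=i_2+k_1-i_1$, $k_3=i_3+j_1-k_1$. The admissible (right) states are the integers $k_1'$ with $\max(0,j_1-j_2)\le k_1'\le\min(j_3,\,j_3+i_1-i_2)$, and one sets $k_2'=k_1'+j_2-j_1$, $k_3'=j_3+i_1-k_1'$. The (deterministic) Schur matching is the bijection from left states to right states \[ k_1'=j_1-\min(j_1,j_2)+\min(k_1,k_2)=k_1+\max(0,j_1-j_2)-\max(0,i_1-i_2). \] It is the unique bijection preserving the monomial weights $x^{j_2}y^{j_1}(xy)^{\min(k_1,k_2)}$ of left states and $x^{k_2'}y^{k_1'}(xy)^{\min(j_1,j_2)}$ of right states ($x,y$ indeterminates); these are the nonzero summands of the two sides of the Yang--Baxter equation of the vertex model for Schur polynomials with the given boundary. -}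

module Defs where

open import Data.Fin.Base using (Fin)
open import Data.Fin.Patterns using (0F; 1F; 2F; 3F; 4F; 5F)
open import Data.Integer.Base using (ℤ; +_; 0ℤ; _+_; _-_; -_; _⊓_; _⊔_; _≤_)
open import Data.Integer.Properties
  using ( ≤-irrelevant; ≤-trans; ≤-reflexive; +-monoʳ-≤; +-monoˡ-≤
        ; neg-distrib-⊓-⊔; mono-≤-distrib-⊔; i≤j⇒0≤j-i; ⊓-comm
        ; module ≤-Reasoning )
open import Data.Integer.Tactic.RingSolver using (solve-∀)
open import Data.List.Base using (List)
open import Data.List.Membership.Propositional using (_∈_)
open import Data.Nat.Base as ℕ using (ℕ)
open import Data.Product.Base using (∃; _×_; _,_)
open import Data.Vec.Base using (Vec; lookup; _[_]≔_)
open import Function.Base using (_∘_)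
open import Function.Bundles using (_⇔_; _⤖_; mk⤖)
open import Level using (0ℓ)
open import Relation.Binary.PropositionalEquality
  using (_≡_; _≗_; refl; sym; trans; cong; cong₂; module ≡-Reasoning)
open import Relation.Unary using (Pred)

infix 10 _³
_³ : Set → Set
A ³ = A × A × A

-- Triples read off a state are integers; ι t ≡ leftTriple s also records that
-- they are nonnegative.
ι : ℕ ³ → ℤ ³
ι (a , h , c) = + a , + h , + c

Finite : {A : Set} → Pred A 0ℓ → Set
Finite {A} P = ∃ λ (xs : List A) → ∀ x → P x ⇔ x ∈ xs

-- On ℕ the truncated difference a ∸ c is exactly max(a - c, 0).
R³ : ℕ ³ → ℕ ³
R³ (a , h , c) = h ℕ.+ (a ℕ.∸ c) , a ℕ.⊓ c , h ℕ.+ (c ℕ.∸ a)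

-- Meant for pairwise distinct positions.
act : {X : Set} {n : ℕ} → (X ³ → X ³) → (a b c : Fin n) → Vec X n → Vec X n
act R a b c v = let (x , y , z) = R (lookup v a , lookup v b , lookup v c)
                in v [ a ]≔ x [ b ]≔ y [ c ]≔ z

-- The six factors are indexed from 0, so R₁₂₃ acts at positions 0, 1, 2.
IsTetrahedronMap : {X : Set} → (X ³ → X ³) → Set
IsTetrahedronMap {X} R =
  R₁₂₃ ∘ R₁₄₅ ∘ R₂₄₆ ∘ R₃₅₆ ≗ R₃₅₆ ∘ R₂₄₆ ∘ R₁₄₅ ∘ R₁₂₃
  where
  R₁₂₃ R₁₄₅ R₂₄₆ R₃₅₆ : Vec X 6 → Vec X 6
  R₁₂₃ = act R 0F 1F 2F
  R₁₄₅ = act R 0F 3F 4F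
  R₂₄₆ = act R 1F 3F 5F
  R₃₅₆ = act R 2F 4F 5F

record Boundary : Set where
  constructor boundary
  field
    n-i₁ n-i₂ n-i₃ n-j₁ n-j₂ n-j₃ : ℕ
    balance : n-i₁ ℕ.+ n-j₂ ℕ.+ n-j₃ ≡ n-i₂ ℕ.+ n-i₃ ℕ.+ n-j₁

  i₁ i₂ i₃ j₁ j₂ j₃ : ℤ
  i₁ = + n-i₁
  i₂ = + n-i₂
  i₃ = + n-i₃
  j₁ = + n-j₁
  j₂ = + n-j₂
  j₃ = + n-j₃

-- States live in ℤ: the upper bounds may be negative, in which case there is
-- no state, and truncated subtraction would wrongly admit 0.
record LeftState (b : Boundary) : Set where
  constructor leftState
  open Boundary b
  field
    k₁    : ℤ
    lower : 0ℤ ⊔ (i₁ - i₂) ≤ k₁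
    upper : k₁ ≤ i₃ ⊓ (i₃ + j₁ - j₂)

  k₂ k₃ : ℤ
  k₂ = i₂ + k₁ - i₁
  k₃ = i₃ + j₁ - k₁

record RightState (b : Boundary) : Set where
  constructor rightState
  open Boundary b
  field
    k₁′   : ℤ
    lower : 0ℤ ⊔ (j₁ - j₂) ≤ k₁′
    upper : k₁′ ≤ j₃ ⊓ (j₃ + i₁ - i₂)

  k₂′ k₃′ : ℤ
  k₂′ = k₁′ + j₂ - j₁
  k₃′ = j₃ + i₁ - k₁′

leftTriple : {b : Boundary} → LeftState b → ℤ ³
leftTriple {b} s = j₁ , k₁ ⊓ k₂ , j₂
  where open Boundary b; open LeftState s

rightTriple : {b : Boundary} → RightState b → ℤ ³
rightTriple {b} s = k₁′ , j₁ ⊓ j₂ , k₂′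
  where open Boundary b; open RightState s

Slice : Boundary → Pred (ℕ ³) 0ℓ
Slice b t = ∃ λ (s : LeftState b) → ι t ≡ leftTriple s

private
  -- max(x - y, 0)
  pos : ℤ → ℤ → ℤ
  pos x y = 0ℤ ⊔ (x - y)

  -min : ∀ z x y → z - (x ⊓ y) ≡ (z - x) ⊔ (z - y)
  -min z x y = trans (cong (λ w → z + w) (neg-distrib-⊓-⊔ x y))
                     (mono-≤-distrib-⊔ (+-monoʳ-≤ z) (- x) (- y))

  self-min : ∀ x y → x - (x ⊓ y) ≡ pos x y
  self-min x y = trans (-min x x y) (cong (_⊔ (x - y)) (x-x x))
    where x-x : ∀ x → x - x ≡ 0ℤ
          x-x = solve-∀

  min-pos : ∀ x y → x ⊓ y ≡ x - pos x y
  min-pos x y = trans (lem x (x ⊓ y)) (cong (λ z → x - z) (self-min x y))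
    where lem : ∀ x m → m ≡ x - (x - m)
          lem = solve-∀

  min-state : ∀ i₁ i₂ k → k ⊓ (i₂ + k - i₁) ≡ k - pos i₁ i₂
  min-state i₁ i₂ k =
    trans (min-pos k (i₂ + k - i₁)) (cong (λ z → k - (0ℤ ⊔ z)) (lem i₁ i₂ k))
    where lem : ∀ i₁ i₂ k → k - (i₂ + k - i₁) ≡ i₁ - i₂
          lem = solve-∀

  upper-pos : ∀ z x y → z ⊓ (z + x - y) ≡ z - pos y x
  upper-pos z x y =
    trans (min-pos z (z + x - y)) (cong (λ w → z - (0ℤ ⊔ w)) (lem z x y))
    where lem : ∀ z x y → z - (z + x - y) ≡ y - x
          lem = solve-∀

  pos-diff : ∀ x y → pos x y ≡ pos y x + (x - y)
  pos-diff x y = begin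
    pos x y                 ≡⟨ self-min x y ⟨
    x - (x ⊓ y)             ≡⟨ lem x y (x ⊓ y) ⟩
    (y - (x ⊓ y)) + (x - y) ≡⟨ cong (λ m → (y - m) + (x - y)) (⊓-comm x y) ⟩
    (y - (y ⊓ x)) + (x - y) ≡⟨ cong (_+ (x - y)) (self-min y x) ⟩
    pos y x + (x - y)       ∎
    where
    open ≡-Reasoning
    lem : ∀ x y m → x - m ≡ (y - m) + (x - y)
    lem = solve-∀

  shift-lower : ∀ p q k → p ≤ k → q ≤ q + (k - p)
  shift-lower p q k p≤k = ≤-trans (≤-reflexive (lem q)) (+-monoʳ-≤ q (i≤j⇒0≤j-i p≤k))
    where lem : ∀ q → q ≡ q + 0ℤ
          lem = solve-∀

  -- The two families of states are exchanged by i ↔ j, so this serves both directions.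
  shift-upper : ∀ i₁ i₂ i₃ j₁ j₂ j₃ k → i₁ + j₂ + j₃ ≡ i₂ + i₃ + j₁ →
                k ≤ i₃ ⊓ (i₃ + j₁ - j₂) →
                pos j₁ j₂ + (k - pos i₁ i₂) ≤ j₃ ⊓ (j₃ + i₁ - i₂)
  shift-upper i₁ i₂ i₃ j₁ j₂ j₃ k bal k≤ = begin
    pos j₁ j₂ + (k - pos i₁ i₂)
      ≤⟨ +-monoʳ-≤ (pos j₁ j₂) (+-monoˡ-≤ (- pos i₁ i₂) k≤) ⟩
    pos j₁ j₂ + (i₃ ⊓ (i₃ + j₁ - j₂) - pos i₁ i₂)
      ≡⟨ cong₂ (λ q u → q + (u - pos i₁ i₂)) (pos-diff j₁ j₂) (upper-pos i₃ j₁ j₂) ⟩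
    (pos j₂ j₁ + (j₁ - j₂)) + ((i₃ - pos j₂ j₁) - pos i₁ i₂)
      ≡⟨ cong (λ p → (pos j₂ j₁ + (j₁ - j₂)) + ((i₃ - pos j₂ j₁) - p)) (pos-diff i₁ i₂) ⟩
    (pos j₂ j₁ + (j₁ - j₂)) + ((i₃ - pos j₂ j₁) - (pos i₂ i₁ + (i₁ - i₂)))
      ≡⟨ lem₁ i₁ i₂ i₃ j₁ j₂ (pos j₂ j₁) (pos i₂ i₁) ⟩
    (i₂ + i₃ + j₁) - (i₁ + j₂) - pos i₂ i₁
      ≡⟨ cong (λ t → t - (i₁ + j₂) - pos i₂ i₁) bal ⟨
    (i₁ + j₂ + j₃) - (i₁ + j₂) - pos i₂ i₁
      ≡⟨ lem₂ i₁ j₂ j₃ (pos i₂ i₁) ⟩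
    j₃ - pos i₂ i₁
      ≡⟨ upper-pos j₃ i₁ i₂ ⟨
    j₃ ⊓ (j₃ + i₁ - i₂) ∎
    where
    open ≤-Reasoning
    lem₁ : ∀ i₁ i₂ i₃ j₁ j₂ q p →
           (q + (j₁ - j₂)) + ((i₃ - q) - (p + (i₁ - i₂))) ≡ (i₂ + i₃ + j₁) - (i₁ + j₂) - p
    lem₁ = solve-∀
    lem₂ : ∀ i₁ j₂ j₃ p → (i₁ + j₂ + j₃) - (i₁ + j₂) - p ≡ j₃ - p
    lem₂ = solve-∀

  shift-shift : ∀ p q k → q + ((p + (k - q)) - p) ≡ k
  shift-shift = solve-∀

  left-≡ : ∀ {b} {s t : LeftState b} → LeftState.k₁ s ≡ LeftState.k₁ t → s ≡ t
  left-≡ {s = leftState k l u} {leftState _ l′ u′} refl =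
    cong₂ (leftState k) (≤-irrelevant l l′) (≤-irrelevant u u′)

  right-≡ : ∀ {b} {s t : RightState b} → RightState.k₁′ s ≡ RightState.k₁′ t → s ≡ t
  right-≡ {s = rightState k l u} {rightState _ l′ u′} refl =
    cong₂ (rightState k) (≤-irrelevant l l′) (≤-irrelevant u u′)

module _ (b : Boundary) where
  open Boundary b

  matchValue : LeftState b → ℤ
  matchValue s = j₁ - (j₁ ⊓ j₂) + (k₁ ⊓ k₂)
    where open LeftState s

  private
    balanceℤ : i₁ + j₂ + j₃ ≡ i₂ + i₃ + j₁
    balanceℤ = cong +_ balance

    matchValue-pos : ∀ s → matchValue s ≡ pos j₁ j₂ + (LeftState.k₁ s - pos i₁ i₂)
    matchValue-pos s = cong₂ _+_ (self-min j₁ j₂) (min-state i₁ i₂ (LeftState.k₁ s))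

  matchValue-shift : ∀ s → matchValue s ≡
                     LeftState.k₁ s + (0ℤ ⊔ (j₁ - j₂)) - (0ℤ ⊔ (i₁ - i₂))
  matchValue-shift s =
    trans (matchValue-pos s) (lem (LeftState.k₁ s) (pos j₁ j₂) (pos i₁ i₂))
    where lem : ∀ k q p → q + (k - p) ≡ k + q - p
          lem = solve-∀

  private
    forward : LeftState b → RightState b
    forward s = rightState (matchValue s)
      (≤-trans (shift-lower (pos i₁ i₂) (pos j₁ j₂) k₁ lower)
               (≤-reflexive (sym (matchValue-pos s))))
      (≤-trans (≤-reflexive (matchValue-pos s))
               (shift-upper i₁ i₂ i₃ j₁ j₂ j₃ k₁ balanceℤ upper))
      where open LeftState s

    backward : RightState b → LeftState b
    backward s = leftState (pos i₁ i₂ + (k₁′ - pos j₁ j₂))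
      (shift-lower (pos j₁ j₂) (pos i₁ i₂) k₁′ lower)
      (shift-upper j₁ j₂ j₃ i₁ i₂ i₃ k₁′ balance′ upper)
      where
      open RightState s
      lem : ∀ x y z → x + y + z ≡ y + z + x
      lem = solve-∀
      balance′ : j₁ + i₂ + i₃ ≡ j₂ + j₃ + i₁
      balance′ = trans (lem j₁ i₂ i₃) (trans (sym balanceℤ) (lem i₁ j₂ j₃))

    backward-forward : ∀ s → backward (forward s) ≡ s
    backward-forward s = left-≡
      (trans (cong (λ k → pos i₁ i₂ + (k - pos j₁ j₂)) (matchValue-pos s))
             (shift-shift (pos j₁ j₂) (pos i₁ i₂) (LeftState.k₁ s)))

    forward-backward : ∀ s → forward (backward s) ≡ s
    forward-backward s = right-≡
      (trans (matchValue-pos (backward s))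
             (shift-shift (pos i₁ i₂) (pos j₁ j₂) (RightState.k₁′ s)))

  schurMatching : LeftState b ⤖ RightState b
  schurMatching = mk⤖
    { to = forward }
    ( (λ {s} {t} eq → trans (sym (backward-forward s))
                            (trans (cong backward eq) (backward-forward t)))
    , (λ s → backward s , λ { refl → forward-backward s }) )

{-# OPTIONS --safe #-}
module Submission where

-- In every state k₁ = h + max(i₁ - i₂, 0), so a state is determined by its active
-- triple and part (i) is a substitution into the matching formula.
--
-- R³ is the ultradiscrete form of the change of parametrisation between the two
-- reduced words of the longest element of S₃.  It is determined by its middle
-- coordinate min(a, c) and by the conservation of a + h and h + c.  Hence, on the
-- two sides of the tetrahedron equation:
--   * both fourth coordinates are min(x₁, x₃, x₆);
--   * on both sides, the second coordinate plus the fourth equals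
--     min(x₁ + x₂, x₅ + min(x₁, x₃));
--   * the fifth coordinates follow by the symmetry 1 ↔ 6, 2 ↔ 5, which exchanges
--     the two sides;
--   * x₁ + x₂ + x₄ and x₂ + x₃ + x₄ + x₅ are conserved by all four factors, which
--     gives the first and third coordinates, and the sixth by symmetry.

open import Defs
open import Algebra.Bundles using (module AbelianGroup)
open import Algebra.Definitions using (Involutive)
import Algebra.Properties.CommutativeSemigroup as CommutativeSemigroupProperties
import Algebra.Properties.Group as GroupProperties
open import Data.Fin.Patterns using (0F; 1F; 2F; 3F; 4F; 5F)
import Data.Integer.Properties as ℤ
open import Data.Integer.Tactic.RingSolver using (solve-∀)
open import Data.List.Base using (List; upTo; map; filter)
open import Data.List.Membership.Propositional using (_∈_)
open import Data.List.Membership.Propositional.Properties using (∈-map∘filter⁺; ∈-map∘filter⁻; ∈-upTo⁺)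
open import Data.Nat.Base as ℕ using (ℕ; suc; z≤n; s≤s)
import Data.Nat.Properties as ℕ
import Data.Nat.Tactic.RingSolver as ℕ-Solver
open import Data.Product.Base using (∃; _×_; _,_; proj₁; proj₂)
open import Data.Product using (∃!)
open import Data.Sum.Base using (inj₁; inj₂)
open import Data.Vec.Base using (Vec; []; _∷_; lookup; tabulate)
open import Data.Vec.Properties using (tabulate∘lookup; tabulate-cong)
open import Function.Base using (_∘_)
open import Function.Bundles using (_⇔_; mk⇔; module Bijection)
open import Relation.Binary.PropositionalEquality
  using (_≡_; refl; sym; trans; cong; cong₂; subst; module ≡-Reasoning)
open import Relation.Unary using (Decidable)

triple-≡ : {A : Set} {x x′ y y′ z z′ : A} → x ≡ x′ → y ≡ y′ → z ≡ z′ → (x , y , z) ≡ (x′ , y′ , z′)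
triple-≡ refl refl refl = refl

-- Conservation laws of `R³` and involutivity.

module _ where
  open import Data.Nat.Base using (_+_; _∸_; _⊓_)
  open import Data.Nat.Properties
  open CommutativeSemigroupProperties +-commutativeSemigroup using (x∙yz≈y∙xz)

  ∸+⊓ : ∀ m n → (m ∸ n) + (m ⊓ n) ≡ m
  ∸+⊓ m n = trans (+-comm (m ∸ n) (m ⊓ n))
                  (trans (cong (_+ (m ∸ n)) (⊓-comm m n)) (m⊓n+n∸m≡n n m))

  -- The first conservation law of `R³`. It is the tool for removing truncated differences: adding
  -- the matching minimum absorbs them.
  R³-leftSum : ∀ x y z → y + (x ∸ z) + (x ⊓ z) ≡ x + y
  R³-leftSum x y z = begin
    y + (x ∸ z) + (x ⊓ z)   ≡⟨ +-assoc y (x ∸ z) (x ⊓ z) ⟩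
    y + (x ∸ z + (x ⊓ z))   ≡⟨ cong (y +_) (∸+⊓ x z) ⟩
    y + x                   ≡⟨ +-comm y x ⟩
    x + y                   ∎
    where open ≡-Reasoning

  R³-rightSum : ∀ x y z → (x ⊓ z) + (y + (z ∸ x)) ≡ y + z
  R³-rightSum x y z = begin
    (x ⊓ z) + (y + (z ∸ x)) ≡⟨ +-comm (x ⊓ z) (y + (z ∸ x)) ⟩
    y + (z ∸ x) + (x ⊓ z)   ≡⟨ cong (y + (z ∸ x) +_) (⊓-comm x z) ⟩
    y + (z ∸ x) + (z ⊓ x)   ≡⟨ R³-leftSum z y x ⟩
    z + y                   ≡⟨ +-comm z y ⟩
    y + z                   ∎
    where open ≡-Reasoning

  -- One of the two truncated differences is always zero.
  R³-middle : ∀ x y z → (y + (x ∸ z)) ⊓ (y + (z ∸ x)) ≡ y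
  R³-middle x y z = begin
    (y + (x ∸ z)) ⊓ (y + (z ∸ x)) ≡⟨ +-distribˡ-⊓ y (x ∸ z) (z ∸ x) ⟨
    y + ((x ∸ z) ⊓ (z ∸ x))       ≡⟨ cong (y +_) ([m∸n]⊓[n∸m]≡0 x z) ⟩
    y + 0                         ≡⟨ +-identityʳ y ⟩
    y                             ∎
    where open ≡-Reasoning

  R³-involutive : Involutive _≡_ R³
  R³-involutive (x , y , z) = triple-≡ left (R³-middle x y z) right
    where
    open ≡-Reasoning
    left : x ⊓ z + (y + (x ∸ z) ∸ (y + (z ∸ x))) ≡ x
    -- The second application restores the middle coordinate `y`, and two uses of the conservation
    -- law restore the sum `x + y`; cancelling `y` leaves `x`.
    left = +-cancelʳ-≡ y _ _ (begin
      x ⊓ z + (y + (x ∸ z) ∸ (y + (z ∸ x))) + y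
        ≡⟨ cong (x ⊓ z + (y + (x ∸ z) ∸ (y + (z ∸ x))) +_) (R³-middle x y z) ⟨
      x ⊓ z + (y + (x ∸ z) ∸ (y + (z ∸ x))) + ((y + (x ∸ z)) ⊓ (y + (z ∸ x)))
        ≡⟨ R³-leftSum (y + (x ∸ z)) (x ⊓ z) (y + (z ∸ x)) ⟩
      y + (x ∸ z) + x ⊓ z
        ≡⟨ R³-leftSum x y z ⟩
      x + y ∎)
    right : x ⊓ z + (y + (z ∸ x) ∸ (y + (x ∸ z))) ≡ z
    right = +-cancelˡ-≡ y _ _ (begin
      y + (x ⊓ z + (y + (z ∸ x) ∸ (y + (x ∸ z))))
        ≡⟨ cong (_+ (x ⊓ z + (y + (z ∸ x) ∸ (y + (x ∸ z))))) (R³-middle x y z) ⟨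
      (y + (x ∸ z)) ⊓ (y + (z ∸ x)) + (x ⊓ z + (y + (z ∸ x) ∸ (y + (x ∸ z))))
        ≡⟨ R³-rightSum (y + (x ∸ z)) (x ⊓ z) (y + (z ∸ x)) ⟩
      x ⊓ z + (y + (z ∸ x))
        ≡⟨ R³-rightSum x y z ⟩
      y + z ∎)

  -- Both sides expand to the minimum of `a + c`, `a + f`, `c + c` and `c + f`.
  ⊓-exchange : ∀ a c f → (a + f) ⊓ (c + (a ⊓ (c ⊓ f))) ≡ (a ⊓ c) + (c ⊓ f)
  ⊓-exchange a c f = begin
    (a + f) ⊓ (c + (a ⊓ m))         ≡⟨ cong ((a + f) ⊓_) (+-distribˡ-⊓ c a m) ⟩
    (a + f) ⊓ ((c + a) ⊓ (c + m))   ≡⟨ ⊓-assoc (a + f) (c + a) (c + m) ⟨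
    ((a + f) ⊓ (c + a)) ⊓ (c + m)   ≡⟨ cong (_⊓ (c + m)) (⊓-comm (a + f) (c + a)) ⟩
    ((c + a) ⊓ (a + f)) ⊓ (c + m)   ≡⟨ cong (λ t → (t ⊓ (a + f)) ⊓ (c + m)) (+-comm c a) ⟩
    ((a + c) ⊓ (a + f)) ⊓ (c + m)   ≡⟨ cong (_⊓ (c + m)) (+-distribˡ-⊓ a c f) ⟨
    (a + m) ⊓ (c + m)               ≡⟨ +-distribʳ-⊓ m a c ⟨
    (a ⊓ c) + m                     ∎
    where open ≡-Reasoning
          m = c ⊓ f

  -- The tetrahedron equation: fourth, second and fifth coordinates.

  R₁₂₃ R₁₄₅ R₂₄₆ R₃₅₆ lhs rhs : Vec ℕ 6 → Vec ℕ 6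
  R₁₂₃ = act R³ 0F 1F 2F
  R₁₄₅ = act R³ 0F 3F 4F
  R₂₄₆ = act R³ 1F 3F 5F
  R₃₅₆ = act R³ 2F 4F 5F
  lhs  = R₁₂₃ ∘ R₁₄₅ ∘ R₂₄₆ ∘ R₃₅₆
  rhs  = R₃₅₆ ∘ R₂₄₆ ∘ R₁₄₅ ∘ R₁₂₃

  fourth-≡ : ∀ v → lookup (lhs v) 3F ≡ lookup (rhs v) 3F
  fourth-≡ (a ∷ _ ∷ c ∷ _ ∷ _ ∷ f ∷ []) = sym (⊓-assoc a c f)

  module _ (a b c d e f : ℕ) where
    private v = a ∷ b ∷ c ∷ d ∷ e ∷ f ∷ []
    open ≡-Reasoning

    lhs-second : lookup (lhs v) 1F + lookup (lhs v) 3F ≡ (a + b) ⊓ (e + (a ⊓ c))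
    -- The extra summand `m` is what `c ∸ f` and `f ∸ c`, hidden in `c′` and `f′`, need in order to
    -- be absorbed by the conservation laws.
    lhs-second = +-cancelʳ-≡ m _ _ (begin
      (a′ ⊓ c′) + p + m                       ≡⟨ +-assoc (a′ ⊓ c′) p m ⟩
      (a′ ⊓ c′) + (p + m)                     ≡⟨ +-distribʳ-⊓ (p + m) a′ c′ ⟩
      (a′ + (p + m)) ⊓ (c′ + (p + m))         ≡⟨ cong₂ _⊓_ first second ⟩
      ((a + b + m) ⊓ (e + (a + f))) ⊓ (e + (c + p))
        ≡⟨ ⊓-assoc (a + b + m) (e + (a + f)) (e + (c + p)) ⟩
      (a + b + m) ⊓ ((e + (a + f)) ⊓ (e + (c + p)))
        ≡⟨ cong ((a + b + m) ⊓_) (+-distribˡ-⊓ e (a + f) (c + p)) ⟨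
      (a + b + m) ⊓ (e + ((a + f) ⊓ (c + p)))
        ≡⟨ cong (λ t → (a + b + m) ⊓ (e + t)) (⊓-exchange a c f) ⟩
      (a + b + m) ⊓ (e + ((a ⊓ c) + m))
        ≡⟨ cong ((a + b + m) ⊓_) (+-assoc e (a ⊓ c) m) ⟨
      (a + b + m) ⊓ (e + (a ⊓ c) + m)
        ≡⟨ +-distribʳ-⊓ m (a + b) (e + (a ⊓ c)) ⟨
      (a + b) ⊓ (e + (a ⊓ c)) + m ∎)
      where
      -- Intermediate coordinates: `c′`, `m`, `f′` are the third, fifth and sixth after `R₃₅₆`; `n`
      -- is the fourth after `R₂₄₆`; `a′` and `p` are the first and fourth after `R₁₄₅`.
      m c′ f′ n p a′ : ℕ
      m  = c ⊓ f
      c′ = e + (c ∸ f)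
      f′ = e + (f ∸ c)
      n  = b ⊓ f′
      p  = a ⊓ m
      a′ = n + (a ∸ m)
      first : a′ + (p + m) ≡ (a + b + m) ⊓ (e + (a + f))
      first = begin
        a′ + (p + m)                      ≡⟨ +-assoc a′ p m ⟨
        a′ + p + m                        ≡⟨ cong (_+ m) (R³-leftSum a n m) ⟩
        a + n + m                         ≡⟨ +-assoc a n m ⟩
        a + (n + m)                       ≡⟨ cong (a +_) (+-distribʳ-⊓ m b f′) ⟩
        a + ((b + m) ⊓ (f′ + m))          ≡⟨ cong (λ t → a + ((b + m) ⊓ t)) (trans (+-comm f′ m) (R³-rightSum c e f)) ⟩
        a + ((b + m) ⊓ (e + f))           ≡⟨ +-distribˡ-⊓ a (b + m) (e + f) ⟩
        (a + (b + m)) ⊓ (a + (e + f))     ≡⟨ cong₂ _⊓_ (sym (+-assoc a b m)) (x∙yz≈y∙xz a e f) ⟩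
        (a + b + m) ⊓ (e + (a + f))       ∎
      second : c′ + (p + m) ≡ e + (c + p)
      second = begin
        c′ + (p + m) ≡⟨ cong (c′ +_) (+-comm p m) ⟩
        c′ + (m + p) ≡⟨ +-assoc c′ m p ⟨
        c′ + m + p   ≡⟨ cong (_+ p) (R³-leftSum c e f) ⟩
        c + e + p    ≡⟨ cong (_+ p) (+-comm c e) ⟩
        e + c + p    ≡⟨ +-assoc e c p ⟩
        e + (c + p)  ∎

    rhs-second : lookup (rhs v) 1F + lookup (rhs v) 3F ≡ (a + b) ⊓ (e + (a ⊓ c))
    rhs-second = begin
      P + (M ∸ f) + (M ⊓ f)        ≡⟨ R³-leftSum M P f ⟩
      M + P                        ≡⟨ +-comm M P ⟩
      P + M                        ≡⟨ +-distribʳ-⊓ M (b + (a ∸ c)) e ⟩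
      (b + (a ∸ c) + M) ⊓ (e + M)  ≡⟨ cong (_⊓ (e + M)) (R³-leftSum a b c) ⟩
      (a + b) ⊓ (e + M)            ∎
      where
      -- `M` is the second coordinate after `R₁₂₃`, and `P` the fourth after `R₁₄₅`.
      M P : ℕ
      M = a ⊓ c
      P = (b + (a ∸ c)) ⊓ e

  second-≡ : ∀ v → lookup (lhs v) 1F ≡ lookup (rhs v) 1F
  second-≡ v@(a ∷ b ∷ c ∷ d ∷ e ∷ f ∷ []) = +-cancelʳ-≡ (lookup (rhs v) 3F) _ _
    (trans (cong (lookup (lhs v) 1F +_) (sym (fourth-≡ v)))
    (trans (lhs-second a b c d e f) (sym (rhs-second a b c d e f))))

  -- R³ commutes with the reversal of triples, so this reversal of the factors
  -- exchanges the two sides of the tetrahedron equation.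
  flip₆ : Vec ℕ 6 → Vec ℕ 6
  flip₆ (a ∷ b ∷ c ∷ d ∷ e ∷ f ∷ []) = f ∷ e ∷ c ∷ d ∷ b ∷ a ∷ []

  flip-R₁₂₃ : ∀ v → flip₆ (R₁₂₃ v) ≡ R₃₅₆ (flip₆ v)
  flip-R₁₂₃ (a ∷ b ∷ c ∷ d ∷ e ∷ f ∷ []) =
    cong (λ t → f ∷ e ∷ b + (c ∸ a) ∷ d ∷ t ∷ b + (a ∸ c) ∷ []) (⊓-comm a c)

  flip-R₁₄₅ : ∀ v → flip₆ (R₁₄₅ v) ≡ R₂₄₆ (flip₆ v)
  flip-R₁₄₅ (a ∷ b ∷ c ∷ d ∷ e ∷ f ∷ []) =
    cong (λ t → f ∷ d + (e ∸ a) ∷ c ∷ t ∷ b ∷ d + (a ∸ e) ∷ []) (⊓-comm a e)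

  flip-R₂₄₆ : ∀ v → flip₆ (R₂₄₆ v) ≡ R₁₄₅ (flip₆ v)
  flip-R₂₄₆ (a ∷ b ∷ c ∷ d ∷ e ∷ f ∷ []) =
    cong (λ t → d + (f ∸ b) ∷ e ∷ c ∷ t ∷ d + (b ∸ f) ∷ a ∷ []) (⊓-comm b f)

  flip-R₃₅₆ : ∀ v → flip₆ (R₃₅₆ v) ≡ R₁₂₃ (flip₆ v)
  flip-R₃₅₆ (a ∷ b ∷ c ∷ d ∷ e ∷ f ∷ []) =
    cong (λ t → e + (f ∸ c) ∷ t ∷ e + (c ∸ f) ∷ d ∷ b ∷ a ∷ []) (⊓-comm c f)

  flip-lhs : ∀ v → flip₆ (lhs v) ≡ rhs (flip₆ v)
  flip-lhs v =
    trans (flip-R₁₂₃ (R₁₄₅ (R₂₄₆ (R₃₅₆ v)))) (cong R₃₅₆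
    (trans (flip-R₁₄₅ (R₂₄₆ (R₃₅₆ v))) (cong R₂₄₆
    (trans (flip-R₂₄₆ (R₃₅₆ v)) (cong R₁₄₅ (flip-R₃₅₆ v))))))

  flip-involutive : ∀ v → flip₆ (flip₆ v) ≡ v
  flip-involutive (_ ∷ _ ∷ _ ∷ _ ∷ _ ∷ _ ∷ []) = refl

  flip-rhs : ∀ v → flip₆ (rhs v) ≡ lhs (flip₆ v)
  flip-rhs v = begin
    flip₆ (rhs v)                 ≡⟨ cong (flip₆ ∘ rhs) (flip-involutive v) ⟨
    flip₆ (rhs (flip₆ (flip₆ v))) ≡⟨ cong flip₆ (flip-lhs (flip₆ v)) ⟨
    flip₆ (flip₆ (lhs (flip₆ v))) ≡⟨ flip-involutive (lhs (flip₆ v)) ⟩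
    lhs (flip₆ v)                 ∎
    where open ≡-Reasoning

  -- Since `flip₆` exchanges the two sides, the equation for `i` at `flip₆ v`, read backwards, is
  -- the equation for the mirrored position `j` at `v`.
  lookup-flip-≡ : ∀ {i j} → (∀ v → lookup v j ≡ lookup (flip₆ v) i) →
                  (∀ v → lookup (lhs v) i ≡ lookup (rhs v) i) →
                  ∀ v → lookup (lhs v) j ≡ lookup (rhs v) j
  lookup-flip-≡ {i} {j} mirror eq v = begin
    lookup (lhs v) j         ≡⟨ mirror (lhs v) ⟩
    lookup (flip₆ (lhs v)) i ≡⟨ cong (λ w → lookup w i) (flip-lhs v) ⟩
    lookup (rhs (flip₆ v)) i ≡⟨ eq (flip₆ v) ⟨
    lookup (lhs (flip₆ v)) i ≡⟨ cong (λ w → lookup w i) (flip-rhs v) ⟨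
    lookup (flip₆ (rhs v)) i ≡⟨ mirror (rhs v) ⟨
    lookup (rhs v) j         ∎
    where open ≡-Reasoning

  fifth-≡ : ∀ v → lookup (lhs v) 4F ≡ lookup (rhs v) 4F
  fifth-≡ = lookup-flip-≡ {1F} {4F} (λ { (_ ∷ _ ∷ _ ∷ _ ∷ _ ∷ _ ∷ []) → refl }) second-≡

  -- The tetrahedron equation: remaining coordinates from conserved sums.

  Conserved : (Vec ℕ 6 → ℕ) → Set
  Conserved q = ∀ v → q (R₁₂₃ v) ≡ q v × q (R₁₄₅ v) ≡ q v × q (R₂₄₆ v) ≡ q v × q (R₃₅₆ v) ≡ q v

  conserved-lhs-rhs : ∀ {q} → Conserved q → ∀ v → q (lhs v) ≡ q (rhs v)
  conserved-lhs-rhs {q} con v = begin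
    q (lhs v)                 ≡⟨ proj₁ (con (R₁₄₅ (R₂₄₆ (R₃₅₆ v)))) ⟩
    q (R₁₄₅ (R₂₄₆ (R₃₅₆ v)))  ≡⟨ proj₁ (proj₂ (con (R₂₄₆ (R₃₅₆ v)))) ⟩
    q (R₂₄₆ (R₃₅₆ v))         ≡⟨ proj₁ (proj₂ (proj₂ (con (R₃₅₆ v)))) ⟩
    q (R₃₅₆ v)                ≡⟨ proj₂ (proj₂ (proj₂ (con v))) ⟩
    q v                       ≡⟨ proj₁ (con v) ⟨
    q (R₁₂₃ v)                ≡⟨ proj₁ (proj₂ (con (R₁₂₃ v))) ⟨
    q (R₁₄₅ (R₁₂₃ v))         ≡⟨ proj₁ (proj₂ (proj₂ (con (R₁₄₅ (R₁₂₃ v))))) ⟨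
    q (R₂₄₆ (R₁₄₅ (R₁₂₃ v)))  ≡⟨ proj₂ (proj₂ (proj₂ (con (R₂₄₆ (R₁₄₅ (R₁₂₃ v)))))) ⟨
    q (rhs v)                 ∎
    where open ≡-Reasoning

  -- The coordinate to be solved for stands first, so that right cancellation of the known ones
  -- isolates it.
  sum₁₂₄ sum₃₂₄₅ : Vec ℕ 6 → ℕ
  sum₁₂₄  v = lookup v 0F + (lookup v 1F + lookup v 3F)
  sum₃₂₄₅ v = lookup v 2F + (lookup v 1F + (lookup v 3F + lookup v 4F))

  R³-leftSum⁺ : ∀ x y z w → y + (x ∸ z) + (x ⊓ z + w) ≡ x + (y + w)
  R³-leftSum⁺ x y z w = trans (sym (+-assoc (y + (x ∸ z)) (x ⊓ z) w))
    (trans (cong (_+ w) (R³-leftSum x y z)) (+-assoc x y w))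

  R³-rightSum⁺ : ∀ x y z w → y + (z ∸ x) + (x ⊓ z + w) ≡ z + (y + w)
  R³-rightSum⁺ x y z w = trans (cong (λ m → y + (z ∸ x) + (m + w)) (⊓-comm x z)) (R³-leftSum⁺ z y x w)

  sum₁₂₄-conserved : Conserved sum₁₂₄
  sum₁₂₄-conserved (a ∷ b ∷ c ∷ d ∷ e ∷ f ∷ []) =
      R³-leftSum⁺ a b c d
    , trans (x∙yz≈y∙xz (d + (a ∸ e)) b (a ⊓ e)) (trans (cong (b +_) (R³-leftSum a d e)) (x∙yz≈y∙xz b a d))
    , cong (a +_) (R³-leftSum b d f)
    , refl

  -- Each factor meets the sum in two neighbouring entries of its triple: 2, 3 for `R₁₂₃`; 4, 5 for
  -- `R₁₄₅`; 2, 4 for `R₂₄₆`; 3, 5 for `R₃₅₆`.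
  sum₃₂₄₅-conserved : Conserved sum₃₂₄₅
  sum₃₂₄₅-conserved (a ∷ b ∷ c ∷ d ∷ e ∷ f ∷ []) =
      R³-rightSum⁺ a b c (d + e)
    , cong (λ t → c + (b + t)) (R³-rightSum a d e)
    , cong (c +_) (R³-leftSum⁺ b d f e)
    , trans (gather (e + (c ∸ f)) b d (c ⊓ f))
        (trans (cong (λ t → b + (d + t)) (R³-leftSum c e f)) (sym (gather c b d e)))
    where
    gather : ∀ x y z w → x + (y + (z + w)) ≡ y + (z + (x + w))
    gather = ℕ-Solver.solve-∀

  first-≡ : ∀ v → lookup (lhs v) 0F ≡ lookup (rhs v) 0F
  first-≡ v = +-cancelʳ-≡ (lookup (rhs v) 1F + lookup (rhs v) 3F) _ _
    (trans (cong (lookup (lhs v) 0F +_) (sym (cong₂ _+_ (second-≡ v) (fourth-≡ v))))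
           (conserved-lhs-rhs sum₁₂₄-conserved v))

  third-≡ : ∀ v → lookup (lhs v) 2F ≡ lookup (rhs v) 2F
  third-≡ v = +-cancelʳ-≡ (lookup (rhs v) 1F + (lookup (rhs v) 3F + lookup (rhs v) 4F)) _ _
    (trans (cong (lookup (lhs v) 2F +_)
             (sym (cong₂ _+_ (second-≡ v) (cong₂ _+_ (fourth-≡ v) (fifth-≡ v)))))
           (conserved-lhs-rhs sum₃₂₄₅-conserved v))

  R³-isTetrahedronMap : IsTetrahedronMap R³
  R³-isTetrahedronMap v = begin
    lhs v                     ≡⟨ tabulate∘lookup (lhs v) ⟨
    tabulate (lookup (lhs v)) ≡⟨ tabulate-cong coordinate-≡ ⟩
    tabulate (lookup (rhs v)) ≡⟨ tabulate∘lookup (rhs v) ⟩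
    rhs v                     ∎
    where
    open ≡-Reasoning
    coordinate-≡ : ∀ i → lookup (lhs v) i ≡ lookup (rhs v) i
    coordinate-≡ 0F = first-≡ v
    coordinate-≡ 1F = second-≡ v
    coordinate-≡ 2F = third-≡ v
    coordinate-≡ 3F = fourth-≡ v
    coordinate-≡ 4F = fifth-≡ v
    coordinate-≡ 5F = lookup-flip-≡ {0F} {5F} (λ { (_ ∷ _ ∷ _ ∷ _ ∷ _ ∷ _ ∷ []) → refl }) first-≡ v

-- Reconstruction of the arrows from the minimum.

open import Data.Integer.Base using (+_; 0ℤ; _+_; _-_; _⊓_; _⊔_; _≤_; +≤+; ∣_∣)
open GroupProperties (AbelianGroup.group ℤ.+-0-abelianGroup) using (∙-cancelʳ)

ι-injective : ∀ {t u} → ι t ≡ ι u → t ≡ u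
ι-injective refl = refl

+[m∸n]≡m-m⊓n : ∀ m n → + (m ℕ.∸ n) ≡ + m - + m ⊓ + n
+[m∸n]≡m-m⊓n m n = begin
  + (m ℕ.∸ n)                           ≡⟨ lemma (+ (m ℕ.∸ n)) (+ m ⊓ + n) ⟩
  + (m ℕ.∸ n) + (+ m ⊓ + n) - + m ⊓ + n ≡⟨ cong (λ k → + k - + m ⊓ + n) (∸+⊓ m n) ⟩
  + m - + m ⊓ + n                       ∎
  where
  open ≡-Reasoning
  lemma : ∀ x y → x ≡ x + y - y
  lemma = solve-∀

⊓-excess : ∀ x y → x ≡ x ⊓ y + ((x - y) ⊔ 0ℤ)
⊓-excess x y with ℤ.≤-total x y
... | inj₁ x≤y = sym (trans (cong₂ _+_ (ℤ.i≤j⇒i⊓j≡i x≤y) (ℤ.i≤j⇒i⊔j≡j (ℤ.i≤j⇒i-j≤0 x≤y))) (ℤ.+-identityʳ x))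
... | inj₂ y≤x = sym (trans (cong₂ _+_ (ℤ.i≥j⇒i⊓j≡j y≤x) (ℤ.i≥j⇒i⊔j≡i (ℤ.i≤j⇒0≤j-i y≤x))) (lemma x y))
  where lemma : ∀ x y → y + (x - y) ≡ x
        lemma = solve-∀

-- The difference of `k₁` and `k₂` is `i₁ - i₂` in every state, so the excess over their minimum
-- depends on the boundary only.
k₁≡h+[i₁-i₂]⁺ : ∀ i₁ i₂ k → k ≡ k ⊓ (i₂ + k - i₁) + ((i₁ - i₂) ⊔ 0ℤ)
k₁≡h+[i₁-i₂]⁺ i₁ i₂ k = trans (⊓-excess k (i₂ + k - i₁))
  (cong (λ d → k ⊓ (i₂ + k - i₁) + (d ⊔ 0ℤ)) (lemma i₁ i₂ k))
  where lemma : ∀ i₁ i₂ k → k - (i₂ + k - i₁) ≡ i₁ - i₂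
        lemma = solve-∀

k₂≡h+[i₂-i₁]⁺ : ∀ i₁ i₂ k → i₂ + k - i₁ ≡ k ⊓ (i₂ + k - i₁) + ((i₂ - i₁) ⊔ 0ℤ)
k₂≡h+[i₂-i₁]⁺ i₁ i₂ k = trans (⊓-excess (i₂ + k - i₁) k)
  (cong₂ (λ h d → h + (d ⊔ 0ℤ)) (ℤ.⊓-comm (i₂ + k - i₁) k) (lemma i₁ i₂ k))
  where lemma : ∀ i₁ i₂ k → i₂ + k - i₁ - k ≡ i₂ - i₁
        lemma = solve-∀

-- The matching on active triples.

module _ {b : Boundary} where
  open Boundary b

  leftState-≡ : {s t : LeftState b} → LeftState.k₁ s ≡ LeftState.k₁ t → s ≡ t
  leftState-≡ {leftState k l u} {leftState _ l′ u′} refl =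
    cong₂ (leftState k) (ℤ.≤-irrelevant l l′) (ℤ.≤-irrelevant u u′)

  rightState-≡ : {s t : RightState b} → RightState.k₁′ s ≡ RightState.k₁′ t → s ≡ t
  rightState-≡ {rightState k l u} {rightState _ l′ u′} refl =
    cong₂ (rightState k) (ℤ.≤-irrelevant l l′) (ℤ.≤-irrelevant u u′)

  match : LeftState b → RightState b
  match = Bijection.to (schurMatching b)

  leftTriple-injective : {s t : LeftState b} → leftTriple s ≡ leftTriple t → s ≡ t
  leftTriple-injective {s} {t} eq = leftState-≡ (begin
    S.k₁                              ≡⟨ k₁≡h+[i₁-i₂]⁺ i₁ i₂ S.k₁ ⟩
    S.k₁ ⊓ S.k₂ + ((i₁ - i₂) ⊔ 0ℤ)    ≡⟨ cong (_+ ((i₁ - i₂) ⊔ 0ℤ)) (cong (proj₁ ∘ proj₂) eq) ⟩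
    T.k₁ ⊓ T.k₂ + ((i₁ - i₂) ⊔ 0ℤ)    ≡⟨ k₁≡h+[i₁-i₂]⁺ i₁ i₂ T.k₁ ⟨
    T.k₁                              ∎)
    where
    open ≡-Reasoning
    module S = LeftState s
    module T = LeftState t

  rightTriple-injective : {s t : RightState b} → rightTriple s ≡ rightTriple t → s ≡ t
  rightTriple-injective eq = rightState-≡ (cong proj₁ eq)

  activeTriple : LeftState b → ℕ ³
  activeTriple s = n-j₁ , ∣ k₁ ⊓ k₂ ∣ , n-j₂
    where open LeftState s

  -- The two arguments of the maximum in `lower` give `0 ≤ k₁` and `0 ≤ k₂`, so the absolute value
  -- in `activeTriple` loses nothing.
  +∣h∣≡h : (s : LeftState b) → let open LeftState s in + ∣ k₁ ⊓ k₂ ∣ ≡ k₁ ⊓ k₂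
  +∣h∣≡h s = ℤ.0≤i⇒+∣i∣≡i (ℤ.⊓-glb 0≤k₁ 0≤k₂)
    where
    open LeftState s
    lemma : ∀ i₁ i₂ k → k - (i₁ - i₂) ≡ i₂ + k - i₁
    lemma = solve-∀
    0≤k₁ : 0ℤ ≤ k₁
    0≤k₁ = ℤ.≤-trans (ℤ.i≤i⊔j 0ℤ (i₁ - i₂)) lower
    0≤k₂ : 0ℤ ≤ k₂
    0≤k₂ = subst (0ℤ ≤_) (lemma i₁ i₂ k₁)
      (ℤ.i≤j⇒0≤j-i (ℤ.≤-trans (ℤ.i≤j⊔i 0ℤ (i₁ - i₂)) lower))

  ι-activeTriple : ∀ s → ι (activeTriple s) ≡ leftTriple s
  ι-activeTriple s = cong (λ h → j₁ , h , j₂) (+∣h∣≡h s)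

  ι-R³-activeTriple : ∀ s → ι (R³ (activeTriple s)) ≡ rightTriple (match s)
  -- The middle entry is `refl` because the integer minimum of two nonnegative literals computes to
  -- the natural one.
  ι-R³-activeTriple s = triple-≡ first refl third
    where
    open LeftState s
    open ≡-Reasoning
    h = k₁ ⊓ k₂
    lemma₁ : ∀ h j m → h + (j - m) ≡ j - m + h
    lemma₁ = solve-∀
    lemma₂ : ∀ h j₁ j₂ m → h + (j₂ - m) ≡ j₁ - m + h + j₂ - j₁
    lemma₂ = solve-∀
    first : + ∣ h ∣ + + (n-j₁ ℕ.∸ n-j₂) ≡ j₁ - j₁ ⊓ j₂ + h
    first = trans (cong₂ _+_ (+∣h∣≡h s) (+[m∸n]≡m-m⊓n n-j₁ n-j₂)) (lemma₁ h j₁ (j₁ ⊓ j₂))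
    third : + ∣ h ∣ + + (n-j₂ ℕ.∸ n-j₁) ≡ j₁ - j₁ ⊓ j₂ + h + j₂ - j₁
    third = begin
      + ∣ h ∣ + + (n-j₂ ℕ.∸ n-j₁)  ≡⟨ cong₂ _+_ (+∣h∣≡h s) (+[m∸n]≡m-m⊓n n-j₂ n-j₁) ⟩
      h + (j₂ - j₂ ⊓ j₁)           ≡⟨ cong (λ m → h + (j₂ - m)) (ℤ.⊓-comm j₂ j₁) ⟩
      h + (j₂ - j₁ ⊓ j₂)           ≡⟨ lemma₂ h j₁ j₂ (j₁ ⊓ j₂) ⟩
      j₁ - j₁ ⊓ j₂ + h + j₂ - j₁   ∎

  activeTriple-unique : ∀ {t} s → ι t ≡ leftTriple s → t ≡ activeTriple s
  activeTriple-unique s eq = ι-injective (trans eq (sym (ι-activeTriple s)))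

  R³-match : ∀ {t} s → ι t ≡ leftTriple s → ι (R³ t) ≡ rightTriple (match s)
  R³-match s eq = trans (cong (ι ∘ R³) (activeTriple-unique s eq)) (ι-R³-activeTriple s)

  -- Finiteness of the slice.

  Admissible : ℕ → Set
  Admissible h = + h + ((i₁ - i₂) ⊔ 0ℤ) ≤ i₃ ⊓ (i₃ + j₁ - j₂)

  admissible? : Decidable Admissible
  admissible? h = _ ℤ.≤? _

  Slice⇒Admissible : ∀ {a h c} → Slice b (a , h , c) → Admissible h
  Slice⇒Admissible {h = h} (s , eq) = subst (_≤ i₃ ⊓ (i₃ + j₁ - j₂)) (begin
      k₁                             ≡⟨ k₁≡h+[i₁-i₂]⁺ i₁ i₂ k₁ ⟩
      k₁ ⊓ k₂ + ((i₁ - i₂) ⊔ 0ℤ)     ≡⟨ cong (λ t → proj₁ (proj₂ t) + ((i₁ - i₂) ⊔ 0ℤ)) eq ⟨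
      + h + ((i₁ - i₂) ⊔ 0ℤ)         ∎) upper
    where
    open LeftState s
    open ≡-Reasoning

  -- In terms of `h` the lower bound on `k₁` becomes `0 ≤ h`, automatic in `ℕ`; only the upper bound
  -- remains. The reconstruction formula at `+ h + p` shows that its minimum is `h`.
  Admissible⇒Slice : ∀ {h} → Admissible h → Slice b (n-j₁ , h , n-j₂)
  Admissible⇒Slice {h} adm = s , cong (λ h → j₁ , h , j₂)
    (∙-cancelʳ p _ _ (k₁≡h+[i₁-i₂]⁺ i₁ i₂ (+ h + p)))
    where
    p = (i₁ - i₂) ⊔ 0ℤ
    s : LeftState b
    s = leftState (+ h + p)
      (ℤ.≤-trans (ℤ.≤-reflexive (ℤ.⊔-comm 0ℤ (i₁ - i₂))) (ℤ.i≤j+i p (+ h)))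
      adm

  Admissible⇒≤ : ∀ {h} → Admissible h → h ℕ.≤ n-i₃
  Admissible⇒≤ {h} adm = ℤ.drop‿+≤+ (begin
    + h                       ≡⟨ ℤ.+-identityʳ (+ h) ⟨
    + h + 0ℤ                  ≤⟨ ℤ.+-monoʳ-≤ (+ h) (ℤ.i≤j⊔i (i₁ - i₂) 0ℤ) ⟩
    + h + ((i₁ - i₂) ⊔ 0ℤ)    ≤⟨ adm ⟩
    i₃ ⊓ (i₃ + j₁ - j₂)       ≤⟨ ℤ.i⊓j≤i i₃ (i₃ + j₁ - j₂) ⟩
    i₃                        ∎)
    where open ℤ.≤-Reasoning

  withActive : ℕ → ℕ ³
  withActive h = n-j₁ , h , n-j₂

  sliceElements : List (ℕ ³)
  -- Only the middle entry varies, and it is at most `n-i₃`; `upTo` excludes its bound, hence `suc`.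
  sliceElements = map withActive (filter admissible? (upTo (suc n-i₃)))

  Slice⇒∈ : ∀ {t} → Slice b t → t ∈ sliceElements
  Slice⇒∈ {a , h , c} (s , eq) = ∈-map∘filter⁺ withActive admissible?
    (h , ∈-upTo⁺ (s≤s (Admissible⇒≤ adm)) , triple-≡ (cong proj₁ t≡) refl (cong (proj₂ ∘ proj₂) t≡) , adm)
    where
    adm = Slice⇒Admissible (s , eq)
    t≡ = activeTriple-unique s eq

  ∈⇒Slice : ∀ {t} → t ∈ sliceElements → Slice b t
  ∈⇒Slice t∈ with h , _ , refl , adm ← ∈-map∘filter⁻ withActive admissible? t∈ = Admissible⇒Slice adm

  Slice-finite : Finite (Slice b)
  Slice-finite = sliceElements , λ _ → mk⇔ Slice⇒∈ ∈⇒Slice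

  -- The matching as a restriction of `R³`.

  leftState-unique : ∀ t → Slice b t → ∃! _≡_ λ (s : LeftState b) → ι t ≡ leftTriple s
  leftState-unique t (s , eq) = s , eq , λ eq′ → leftTriple-injective (trans (sym eq) eq′)

  -- Existence is surjectivity of the matching; uniqueness is injectivity of the involution `R³`.
  slicePoint-unique : ∀ s′ → ∃! _≡_ λ t → Slice b t × ι (R³ t) ≡ rightTriple s′
  slicePoint-unique s′ = activeTriple s , ((s , ι-activeTriple s) , eq) , unique
    where
    s = proj₁ (Bijection.strictlySurjective (schurMatching b) s′)
    eq : ι (R³ (activeTriple s)) ≡ rightTriple s′
    eq = trans (ι-R³-activeTriple s)
      (cong rightTriple (proj₂ (Bijection.strictlySurjective (schurMatching b) s′)))
    unique : ∀ {t} → Slice b t × ι (R³ t) ≡ rightTriple s′ → activeTriple s ≡ t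
    unique {t} (_ , eq′) = begin
      activeTriple s           ≡⟨ R³-involutive (activeTriple s) ⟨
      R³ (R³ (activeTriple s)) ≡⟨ cong R³ (ι-injective (trans eq (sym eq′))) ⟩
      R³ (R³ t)                ≡⟨ R³-involutive t ⟩
      t                        ∎
      where open ≡-Reasoning

  match⇔R³ : ∀ t s s′ → ι t ≡ leftTriple s → (match s ≡ s′) ⇔ (ι (R³ t) ≡ rightTriple s′)
  match⇔R³ t s s′ eq = mk⇔
    (λ { refl → R³-match s eq })
    (λ eq′ → rightTriple-injective (trans (sym (R³-match s eq)) eq′))

-- Assembling `R³` from all boundaries.

boundaryThrough : ℕ ³ → Boundary
-- Taking `i₁` and `i₂` zero forces `k₁` and `k₂` to equal `h`. With `i₃` equal to `h + c` the two
-- upper bounds are `h + c` and `h + a`, both at least `h`; the balance condition then dictates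
-- `j₃`.
boundaryThrough (a , h , c) = boundary 0 0 (h ℕ.+ c) a c (h ℕ.+ a) (begin
  c ℕ.+ (h ℕ.+ a) ≡⟨ ℕ.+-assoc c h a ⟨
  c ℕ.+ h ℕ.+ a   ≡⟨ cong (ℕ._+ a) (ℕ.+-comm c h) ⟩
  h ℕ.+ c ℕ.+ a   ∎)
  where open ≡-Reasoning

Slice-boundaryThrough : ∀ t → Slice (boundaryThrough t) t
Slice-boundaryThrough t@(a , h , c) = Admissible⇒Slice {boundaryThrough t} (ℤ.⊓-glb
  (+≤+ (ℕ.+-monoʳ-≤ h z≤n))
  (ℤ.≤-trans (+≤+ (ℕ.+-monoʳ-≤ h z≤n)) (ℤ.≤-reflexive (lemma (+ h) (+ a) (+ c)))))
  where lemma : ∀ h a c → h + a ≡ h + c + a - c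
        lemma = solve-∀

-- The graph of `R³` is the union of the graphs of all matchings: each triple lies on the slice of
-- its own `boundaryThrough`, and matchings through the same triple agree because each is given by
-- `R³`.
R³⇔matching : ∀ t u → R³ t ≡ u ⇔
  (∃ λ (b : Boundary) → ∃ λ (s : LeftState b) → ι t ≡ leftTriple s × ι u ≡ rightTriple (match s))
R³⇔matching t u = mk⇔
  (λ { refl → let s , eq = Slice-boundaryThrough t in boundaryThrough t , s , eq , R³-match s eq })
  (λ { (_ , s , eq , eq′) → ι-injective (trans (R³-match s eq) (sym eq′)) })

proposition4p5 :
  -- (i)
  (∀ (b : Boundary) (s : LeftState b) →
     ∃ λ (t : ℕ ³) → ι t ≡ leftTriple s
                   × ι (R³ t) ≡ rightTriple (Bijection.to (schurMatching b) s))
  -- (ii) reconstruction of the remaining arrows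
  × (∀ (b : Boundary) (s : LeftState b) →
       let open Boundary b
           open LeftState s
           open RightState (Bijection.to (schurMatching b) s)
           h = k₁ ⊓ k₂
       in k₁ ≡ h + ((i₁ - i₂) ⊔ 0ℤ)
        × k₂ ≡ h + ((i₂ - i₁) ⊔ 0ℤ)
        × k₃ ≡ i₃ + j₁ - k₁
        × k₃′ ≡ j₃ + i₁ - k₁′)
  -- (ii) the matching is the restriction of R³ to the finite slice
  × (∀ (b : Boundary) →
       Finite (Slice b)
     × (∀ t → Slice b t → ∃! _≡_ λ (s : LeftState b) → ι t ≡ leftTriple s)
     × (∀ (s′ : RightState b) → ∃! _≡_ λ t → Slice b t × ι (R³ t) ≡ rightTriple s′)
     × (∀ t (s : LeftState b) (s′ : RightState b) → ι t ≡ leftTriple s →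
          (Bijection.to (schurMatching b) s ≡ s′) ⇔ (ι (R³ t) ≡ rightTriple s′)))
  -- (iii)
  × Involutive _≡_ R³
  × IsTetrahedronMap R³
  -- (iv)
  × (∀ (t : ℕ ³) → ∃ λ (b : Boundary) → ∃ λ (s : LeftState b) → ι t ≡ leftTriple s)
  × (∀ (t u : ℕ ³) →
       R³ t ≡ u ⇔
       (∃ λ (b : Boundary) → ∃ λ (s : LeftState b) →
          ι t ≡ leftTriple s
        × ι u ≡ rightTriple (Bijection.to (schurMatching b) s)))
proposition4p5 =
    (λ b s → activeTriple s , ι-activeTriple s , ι-R³-activeTriple s)
  , (λ b s → let open Boundary b; open LeftState s in
       k₁≡h+[i₁-i₂]⁺ i₁ i₂ k₁ , k₂≡h+[i₂-i₁]⁺ i₁ i₂ k₁ , refl , refl)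
  , (λ b → Slice-finite , leftState-unique , slicePoint-unique , match⇔R³)
  , R³-involutive
  , R³-isTetrahedronMap
  , (λ t → boundaryThrough t , Slice-boundaryThrough t)
  , R³⇔matching
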